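{- There is an absolute constant $c$ such that the following holds. For a positive integer $m$, let $M$ be an ordered matching on $2m$ vertices with interval chromatic number $2$, chosen uniformly at random among all such matchings. Then, with probability tending to $1$ as $m \to \infty$, $$r_<(M, K_3) \leq c\, m^{24/13}.$$
   Context: An ordered graph on $n$ vertices is a graph whose vertex set is $\{1,\dots,n\}$ with its natural order. An ordered matching is an ordered graph in which every vertex has degree exactly $1$. A copy of an ordered graph $G$ on $\{1,\dots,m\}$ inside an edge-colored ordered complete graph on $\{1,\dots,N\}$ is an increasing map $\phi$ from $\{1,\dots,m\}$ to $\{1,\dots,N\}$ sending every edge of $G$ to an edge; it is red (resp. blue) if all image edges are red (resp. blue). For ordered graphs $G,H$, $r_<(G,H)$ is the smallest $N$ such that every red/blue coloring of the edges of the ordered complete graph on $\{1,\dots,N\}$ contains a red copy of $G$ or a blue copy of $H$. $K_3$ is the triangle. The interval chromatic number of an ordered graph is the minimum number of contiguous intervals into which its vertex set can be partitioned so that each interval is an independent set. Thus an ordered matching on $2m$ vertices has interval chromatic number $2$ exactly when every edge joins a vertex in $\{1,\dots,m\}$ to a vertex in $\{m+1,\dots,2m\}$. -}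

module Defs where

open import Data.Nat using (ℕ; _+_; _*_; _^_; _≤_)
open import Data.Fin using (Fin; _<_; _↑ˡ_; _↑ʳ_)
open import Data.Bool using (Bool; true; false)
open import Data.Vec using (Vec; lookup)
open import Data.Product using (Σ; ∃; _×_)
open import Data.Sum using (_⊎_)
open import Relation.Binary.PropositionalEquality using (_≡_)

-- A red/blue colouring of the edges of the ordered complete graph on N
-- vertices: the colour of the edge {i,j} with i < j is  col i j
-- (true = red, false = blue).  Values col i j with i ≥ j are irrelevant.
Colouring : ℕ → Set
Colouring N = Fin N → Fin N → Bool

Increasing : ∀ {a N} → (Fin a → Fin N) → Set
Increasing {a} φ = ∀ (i j : Fin a) → i < j → φ i < φ j

-- Ordered matchings on 2m vertices with interval chromatic number 2
-- correspond bijectively to permutations σ of {1..m}: vertex i of the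
-- left half {1..m} is matched to vertex m + σ(i) of the right half.
-- A permutation is represented as a vector v of length m with injective lookup.
IsPerm : ∀ {m} → Vec (Fin m) m → Set
IsPerm {m} v = ∀ (i j : Fin m) → lookup v i ≡ lookup v j → i ≡ j

RedMatchingCopy : ∀ {m N} → Vec (Fin m) m → Colouring N → Set
RedMatchingCopy {m} {N} σ col =
  Σ (Fin (m + m) → Fin N) λ φ →
    Increasing φ ×
    (∀ (i : Fin m) → col (φ (i ↑ˡ m)) (φ (m ↑ʳ lookup σ i)) ≡ true)

BlueTriangle : ∀ {N} → Colouring N → Set
BlueTriangle {N} col =
  Σ (Fin N) λ a → Σ (Fin N) λ b → Σ (Fin N) λ c →
    a < b × b < c × col a b ≡ false × col a c ≡ false × col b c ≡ false

Arrows : ∀ {m} → ℕ → Vec (Fin m) m → Set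
Arrows N σ = ∀ (col : Colouring N) → RedMatchingCopy σ col ⊎ BlueTriangle col

-- r_<(M_σ, K₃) ≤ c · m^(24/13).  Since r_< is the least N with Arrows N,
-- r_< ≤ X  iff  some N ≤ X has Arrows N; and for naturals N, c, m,
-- N ≤ c · m^(24/13)  iff  N^13 ≤ c^13 · m^24.
RamseyBound : (c m : ℕ) → Vec (Fin m) m → Set
RamseyBound c m σ = ∃ λ (N : ℕ) → (N ^ 13 ≤ (c ^ 13) * (m ^ 24)) × Arrows N σ

{-# OPTIONS --safe #-}

-- Blue neighbourhoods in a colouring without blue triangles are red cliques, so we may assume that all
-- blue degrees are at most D = 2m.  Place left vertex i at i + t + l⌊i/H⌋, and cut the right vertices into
-- groups of w consecutive ones; each group may slide by any k < 2D.  Let b(i) be the number of slides at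
-- which the edge at i is blue, so b(i) ≤ D.  If no slide of a group works, the b(i) of the group add up to
-- at least 2D, whence Σ b(i) b(j) ≥ 2D² over the pairs i ≠ j of the group.  So it suffices to find (t, l) for
-- which the sum of b(i) b(j) over all pairs i ≠ j with right ends in a common group is less than 2D².
-- Averaging over (t, l) finds one: when ⌊i/H⌋ ≠ ⌊j/H⌋ the positions of i and j determine (t, l), which makes
-- the two factors essentially independent, and for a random matching there are only O(Hw) pairs with
-- ⌊i/H⌋ = ⌊j/H⌋ whose right ends share a group.  With x ≈ m^(1/13) this works for w = x², H = x⁷, t < x²⁴
-- and l < x¹⁸, and it uses O(x²⁴) vertices.
module Submission where

open import Defs
open import Algebra.Properties.CommutativeSemigroup using (interchange)
open import Data.Bool using (Bool; true; false; if_then_else_)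
import Data.Bool.Properties as Bool
open import Data.Empty using (⊥-elim)
open import Data.Fin using (Fin; zero; suc; toℕ; punchIn; punchOut; _↑ˡ_; _↑ʳ_; splitAt; inject≤)
import Data.Fin as F
open import Data.Fin.Permutation.Components using (transpose; transpose-inverse)
open import Data.Fin.Properties using (toℕ<n; toℕ-injective; toℕ-fromℕ<; toℕ-inject≤; toℕ-↑ˡ; toℕ-↑ʳ; splitAt-↑ˡ; splitAt-↑ʳ; splitAt⁻¹-↑ˡ; splitAt⁻¹-↑ʳ; punchIn-punchOut; punchIn-injective; punchInᵢ≢i; punchOut-injective)
import Data.Fin.Properties as Fin
open import Data.List using (List; []; _∷_; _++_; length; map; upTo; allFin; filter; cartesianProduct; cartesianProductWith)
import Data.List as List
open import Data.List.Membership.Propositional using (_∈_)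
open import Data.List.Membership.Propositional.Properties
open import Data.List.Properties using (map-++; map-∘; length-upTo; length-tabulate; length-++; length-map)
open import Data.List.Relation.Unary.All using (All)
import Data.List.Relation.Unary.All as All
open import Data.List.Relation.Unary.AllPairs using (AllPairs; []; _∷_)
import Data.List.Relation.Unary.AllPairs.Properties as AllPairs
open import Data.List.Relation.Unary.Any using (here; there)
open import Data.List.Relation.Unary.Unique.Propositional using (Unique)
import Data.List.Relation.Unary.Unique.Propositional.Properties as Uniq
open import Data.Nat
open import Data.Nat.DivMod
open import Data.Nat.ListAction using (sum)
open import Data.Nat.ListAction.Properties using (sum-++)
open import Data.Nat.Properties
open import Data.Nat.Tactic.RingSolver using (solve-∀)
open import Data.Product using (Σ; ∃; ∃₂; _×_; _,_; proj₁; proj₂)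
open import Data.Sum using (_⊎_; inj₁; inj₂; [_,_]′)
open import Data.Unit using (tt)
open import Data.Vec using (Vec; []; _∷_; lookup; tabulate)
import Data.Vec as Vec
open import Data.Vec.Properties using (lookup-map; lookup∘tabulate; tabulate∘lookup; tabulate-cong; tabulate-∘; ∷-injective)
open import Function using (_∘_; id; case_of_)
open import Relation.Binary.PropositionalEquality
open import Relation.Nullary using (Dec; yes; no; does; ¬_; ¬?; contradiction)
open import Relation.Nullary.Decidable using (_×-dec_)
open import Relation.Unary using (Decidable)

private variable
  A B C : Set

-- Finite sums

length-allFin : ∀ n → length (allFin n) ≡ n
length-allFin n = length-tabulate {n = n} (λ i → i)

length-cartesianProductWith : ∀ (f : A → B → C) xs ys →
                              length (cartesianProductWith f xs ys) ≡ length xs * length ys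
length-cartesianProductWith f []       ys = refl
length-cartesianProductWith f (x ∷ xs) ys = trans (length-++ (map (f x) ys))
  (cong₂ _+_ (length-map (f x) ys) (length-cartesianProductWith f xs ys))

∑ : List A → (A → ℕ) → ℕ
∑ xs f = sum (map f xs)

𝟙 : {P : Set} → Dec P → ℕ
𝟙 d = if does d then 1 else 0

𝟙-yes : ∀ {P : Set} (d : Dec P) → P → 𝟙 d ≡ 1
𝟙-yes (yes _) _ = refl
𝟙-yes (no ¬p) p = contradiction p ¬p

𝟙-cover : ∀ {P Q R : Set} (p : Dec P) (q : Dec Q) (r : Dec R) → (P → Q ⊎ R) → 𝟙 p ≤ 𝟙 q + 𝟙 r
𝟙-cover (no _)  q r _ = z≤n
𝟙-cover (yes p) q r cover with cover p
... | inj₁ x = ≤-trans (≤-reflexive (sym (𝟙-yes q x))) (m≤m+n _ _)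
... | inj₂ x = ≤-trans (≤-reflexive (sym (𝟙-yes r x))) (m≤n+m _ _)

𝟙-*-≤ : ∀ {P : Set} (d : Dec P) {x y} → (P → x ≤ y) → 𝟙 d * x ≤ y
𝟙-*-≤ (yes p) {x} x≤y = ≤-trans (≤-reflexive (+-identityʳ x)) (x≤y p)
𝟙-*-≤ (no _)      x≤y = z≤n

∑-mono : ∀ (xs : List A) {f g : A → ℕ} → (∀ {x} → x ∈ xs → f x ≤ g x) → ∑ xs f ≤ ∑ xs g
∑-mono []       f≤g = z≤n
∑-mono (x ∷ xs) f≤g = +-mono-≤ (f≤g (here refl)) (∑-mono xs (f≤g ∘ there))

∑-cong : ∀ (xs : List A) {f g : A → ℕ} → (∀ x → f x ≡ g x) → ∑ xs f ≡ ∑ xs g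
∑-cong []       f≡g = refl
∑-cong (x ∷ xs) f≡g = cong₂ _+_ (f≡g x) (∑-cong xs f≡g)

∑-++ : ∀ (xs ys : List A) (f : A → ℕ) → ∑ (xs ++ ys) f ≡ ∑ xs f + ∑ ys f
∑-++ xs ys f = trans (cong sum (map-++ f xs ys)) (sum-++ (map f xs) (map f ys))

∑-+ : ∀ (xs : List A) (f g : A → ℕ) → ∑ xs (λ x → f x + g x) ≡ ∑ xs f + ∑ xs g
∑-+ []       f g = refl
∑-+ (x ∷ xs) f g = trans (cong (f x + g x +_) (∑-+ xs f g)) (interchange +-commutativeSemigroup (f x) (g x) _ _)

∑-*ˡ : ∀ (xs : List A) c (f : A → ℕ) → ∑ xs (λ x → c * f x) ≡ c * ∑ xs f
∑-*ˡ []       c f = sym (*-zeroʳ c)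
∑-*ˡ (x ∷ xs) c f = trans (cong (c * f x +_) (∑-*ˡ xs c f)) (sym (*-distribˡ-+ c (f x) _))

∑-*ʳ : ∀ (xs : List A) c (f : A → ℕ) → ∑ xs (λ x → f x * c) ≡ ∑ xs f * c
∑-*ʳ xs c f = trans (∑-cong xs (λ x → *-comm (f x) c)) (trans (∑-*ˡ xs c f) (*-comm c _))

∑-const : ∀ (xs : List A) c → ∑ xs (λ _ → c) ≡ length xs * c
∑-const []       c = refl
∑-const (x ∷ xs) c = cong (c +_) (∑-const xs c)

∑-≤-length : ∀ (xs : List A) {f : A → ℕ} {c} → (∀ {x} → x ∈ xs → f x ≤ c) → ∑ xs f ≤ length xs * c
∑-≤-length xs {c = c} f≤c = ≤-trans (∑-mono xs f≤c) (≤-reflexive (∑-const xs c))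

∑-swap : ∀ (xs : List A) (ys : List B) (f : A → B → ℕ) →
         ∑ xs (λ x → ∑ ys (f x)) ≡ ∑ ys (λ y → ∑ xs (λ x → f x y))
∑-swap []       ys f = sym (trans (∑-const ys 0) (*-zeroʳ (length ys)))
∑-swap (x ∷ xs) ys f = trans (cong (∑ ys (f x) +_) (∑-swap xs ys f)) (sym (∑-+ ys (f x) _))

∑-× : ∀ (xs : List A) (ys : List B) (f : A × B → ℕ) →
      ∑ (cartesianProduct xs ys) f ≡ ∑ xs (λ x → ∑ ys (λ y → f (x , y)))
∑-× []       ys f = refl
∑-× (x ∷ xs) ys f = trans (∑-++ (map (x ,_) ys) _ f)
  (cong₂ _+_ (cong sum (sym (map-∘ {g = f} {f = x ,_} ys))) (∑-× xs ys f))

∑-product : ∀ (xs : List A) (ys : List B) (f : A → ℕ) (g : B → ℕ) →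
            ∑ xs (λ x → ∑ ys (λ y → f x * g y)) ≡ ∑ xs f * ∑ ys g
∑-product xs ys f g = trans (∑-cong xs (λ x → ∑-*ˡ ys (f x) g)) (∑-*ʳ xs (∑ ys g) f)

-- Induction on `xs`: its head occurs somewhere in `ys` and is deleted there. As `xs` has no
-- repetitions, the tail still lies in what remains.
∑-⊆ : ∀ {xs : List A} (ys : List A) (f : A → ℕ) → Unique xs → (∀ {x} → x ∈ xs → x ∈ ys) → ∑ xs f ≤ ∑ ys f
∑-⊆ ys f []                         xs⊆ys = z≤n
∑-⊆ ys f (_∷_ {x} {xs} x∉xs xs!) xs⊆ys with ∈-∃++ (xs⊆ys (here refl))
... | us , vs , refl = begin
  f x + ∑ xs f              ≤⟨ +-monoʳ-≤ (f x) (∑-⊆ (us ++ vs) f xs! drop-x) ⟩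
  f x + ∑ (us ++ vs) f      ≡⟨ cong (f x +_) (∑-++ us vs f) ⟩
  f x + (∑ us f + ∑ vs f)   ≡⟨ +-assoc (f x) (∑ us f) (∑ vs f) ⟨
  f x + ∑ us f + ∑ vs f     ≡⟨ cong (_+ ∑ vs f) (+-comm (f x) (∑ us f)) ⟩
  ∑ us f + f x + ∑ vs f     ≡⟨ +-assoc (∑ us f) (f x) (∑ vs f) ⟩
  ∑ us f + (f x + ∑ vs f)   ≡⟨ ∑-++ us (x ∷ vs) f ⟨
  ∑ (us ++ x ∷ vs) f        ∎
  where
  open ≤-Reasoning
  drop-x : ∀ {y} → y ∈ xs → y ∈ us ++ vs
  drop-x y∈xs with ∈-++⁻ us (xs⊆ys (there y∈xs))
  ... | inj₁ y∈us          = ∈-++⁺ˡ y∈us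
  ... | inj₂ (here refl)   = contradiction refl (All.lookup x∉xs y∈xs)
  ... | inj₂ (there y∈vs)  = ∈-++⁺ʳ us y∈vs

∑-∈ : ∀ {xs : List A} (f : A → ℕ) {x} → x ∈ xs → f x ≤ ∑ xs f
∑-∈ f (here refl)  = m≤m+n _ _
∑-∈ f (there x∈xs) = ≤-trans (∑-∈ f x∈xs) (m≤n+m _ _)

-- The image of `xs` under `h` is a repetition-free part of `ys`. This is the change of variables
-- behind the counting: slides are sent injectively to columns, shifts to rows or pairs of rows,
-- permutations to permutations.
∑-injection : ∀ {xs : List A} {ys : List B} (h : A → B) (f : B → ℕ) → Unique xs →
              (∀ {x} → x ∈ xs → h x ∈ ys) →
              (∀ {x y} → x ∈ xs → y ∈ xs → h x ≡ h y → x ≡ y) →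
              ∑ xs (f ∘ h) ≤ ∑ ys f
∑-injection {xs = xs} {ys} h f xs! h∈ys h-inj =
  ≤-trans (≤-reflexive (cong sum (map-∘ {g = f} {f = h} xs))) (∑-⊆ ys f (map! xs! h-inj) ⊆ys)
  where
  ⊆ys : ∀ {y} → y ∈ map h xs → y ∈ ys
  ⊆ys y∈ with ∈-map⁻ h y∈
  ... | x , x∈xs , refl = h∈ys x∈xs
  map! : ∀ {xs} → Unique xs → (∀ {x y} → x ∈ xs → y ∈ xs → h x ≡ h y → x ≡ y) → Unique (map h xs)
  map! []            _   = []
  map! (x∉xs ∷ xs!) inj =
    All.tabulate (λ y∈ → λ { refl → let _ , y∈xs , eq = ∈-map⁻ h y∈ in
      All.lookup x∉xs y∈xs (inj (here refl) (there y∈xs) eq) })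
    ∷ map! xs! (λ p q → inj (there p) (there q))

∑-filter : ∀ {P : A → Set} (P? : Decidable P) (f : A → ℕ) xs →
           ∑ xs (λ x → 𝟙 (P? x) * f x) ≡ ∑ (filter P? xs) f
∑-filter P? f []       = refl
∑-filter P? f (x ∷ xs) with does (P? x)
... | true  = cong₂ _+_ (*-identityˡ (f x)) (∑-filter P? f xs)
... | false = ∑-filter P? f xs

∑-𝟙 : ∀ {P : A → Set} (P? : Decidable P) xs → ∑ xs (λ x → 𝟙 (P? x)) ≡ length (filter P? xs)
∑-𝟙 P? xs = trans (∑-cong xs (λ x → sym (*-identityʳ (𝟙 (P? x)))))
  (trans (∑-filter P? (λ _ → 1) xs) (trans (∑-const (filter P? xs) 1) (*-identityʳ _)))

count-≤ : ∀ {P : A → Set} (P? : Decidable P) {xs} n (h : A → ℕ) → Unique xs →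
          (∀ {x} → P x → h x < n) → (∀ {x y} → P x → P y → h x ≡ h y → x ≡ y) →
          ∑ xs (λ x → 𝟙 (P? x)) ≤ n
count-≤ P? {xs} n h xs! h<n h-inj = begin
  ∑ xs (λ x → 𝟙 (P? x))        ≡⟨ ∑-cong xs (λ x → sym (*-identityʳ (𝟙 (P? x)))) ⟩
  ∑ xs (λ x → 𝟙 (P? x) * 1)    ≡⟨ ∑-filter P? (λ _ → 1) xs ⟩
  ∑ (filter P? xs) (λ _ → 1)   ≤⟨ ∑-injection h (λ _ → 1) (Uniq.filter⁺ P? xs!)
                                    (λ x∈ → ∈-upTo⁺ (h<n (proj₂ (∈-filter⁻ P? {xs = xs} x∈))))
                                    (λ x∈ y∈ → h-inj (proj₂ (∈-filter⁻ P? {xs = xs} x∈)) (proj₂ (∈-filter⁻ P? {xs = xs} y∈))) ⟩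
  ∑ (upTo n) (λ _ → 1)         ≡⟨ ∑-const (upTo n) 1 ⟩
  length (upTo n) * 1          ≡⟨ *-identityʳ _ ⟩
  length (upTo n)              ≡⟨ length-upTo n ⟩
  n                            ∎
  where open ≤-Reasoning

∑-pigeonhole : ∀ (xs : List A) (f : A → ℕ) c → ∑ xs f < length xs * c → ∃ λ x → x ∈ xs × f x < c
∑-pigeonhole (x ∷ xs) f c lt with f x <? c
... | yes fx<c = x , here refl , fx<c
... | no  fx≮c = let y , y∈xs , fy<c = ∑-pigeonhole xs f c (+-cancelˡ-< c _ _
                       (≤-<-trans (+-monoˡ-≤ (∑ xs f) (≮⇒≥ fx≮c)) lt))
                 in y , there y∈xs , fy<c

∑-δ : ∀ {P : A → Set} (P? : Decidable P) {xs} a (f : A → ℕ) → Unique xs → (∀ {x} → P x → x ≡ a) →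
      ∑ xs (λ x → 𝟙 (P? x) * f x) ≤ f a
∑-δ P? {[]}     a f _            P⇒≡ = z≤n
∑-δ P? {x ∷ xs} a f (x∉xs ∷ xs!) P⇒≡ with P? x
... | no  _  = ∑-δ P? a f xs! P⇒≡
... | yes Px with P⇒≡ Px
...   | refl = begin
  f x + 0 + ∑ xs (λ y → 𝟙 (P? y) * f y)  ≡⟨ cong₂ _+_ (+-identityʳ (f x)) (∑-filter P? f xs) ⟩
  f x + ∑ (filter P? xs) f               ≤⟨ +-monoʳ-≤ (f x) (∑-≤-length (filter P? xs)
       (λ y∈ → let y∈xs , Py = ∈-filter⁻ P? {xs = xs} y∈ in ⊥-elim (All.lookup x∉xs y∈xs (sym (P⇒≡ Py))))) ⟩
  f x + length (filter P? xs) * 0        ≡⟨ cong (f x +_) (*-zeroʳ (length (filter P? xs))) ⟩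
  f x + 0                                ≡⟨ +-identityʳ (f x) ⟩
  f x                                    ∎
  where open ≤-Reasoning

-- Placing the matching edges along blue-free cells

-- Two points determine a line: comparing the equations at `u` and `v` isolates the slope. With `u`
-- and `v` the segment numbers of two left vertices, their positions determine the intercept `t` and
-- the slope `l`.
lines-meet-once : ∀ {a b λ₁ λ₂ u v} → a + λ₁ * u ≡ b + λ₂ * u → a + λ₁ * v ≡ b + λ₂ * v → ¬ u ≡ v →
                  a ≡ b × λ₁ ≡ λ₂
lines-meet-once {a} {b} {λ₁} {λ₂} {u} {v} eq-u eq-v u≢v = +-cancelʳ-≡ (λ₂ * u) a b (subst (λ l → a + l * u ≡ _) slope eq-u) , slope
  where
  shifted : ∀ {u v} → u ≤ v → ¬ u ≡ v → a + λ₁ * u ≡ b + λ₂ * u → a + λ₁ * v ≡ b + λ₂ * v → λ₁ ≡ λ₂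
  shifted {u} {v} u≤v u≢v eq-u eq-v with m≤n⇒∃[o]m+o≡n u≤v
  ... | zero  , refl = contradiction (sym (+-identityʳ u)) u≢v
  ... | suc d , refl = *-cancelʳ-≡ λ₁ λ₂ (suc d) (+-cancelˡ-≡ (a + λ₁ * u) _ _ (begin
    a + λ₁ * u + λ₁ * suc d   ≡⟨ +-assoc a _ _ ⟩
    a + (λ₁ * u + λ₁ * suc d) ≡⟨ cong (a +_) (*-distribˡ-+ λ₁ u (suc d)) ⟨
    a + λ₁ * (u + suc d)      ≡⟨ eq-v ⟩
    b + λ₂ * (u + suc d)      ≡⟨ cong (b +_) (*-distribˡ-+ λ₂ u (suc d)) ⟩
    b + (λ₂ * u + λ₂ * suc d) ≡⟨ +-assoc b _ _ ⟨
    b + λ₂ * u + λ₂ * suc d   ≡⟨ cong (_+ λ₂ * suc d) eq-u ⟨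
    a + λ₁ * u + λ₂ * suc d   ∎))
    where open ≡-Reasoning
  slope : λ₁ ≡ λ₂
  slope with ≤-total u v
  ... | inj₁ u≤v = shifted u≤v u≢v eq-u eq-v
  ... | inj₂ v≤u = shifted v≤u (u≢v ∘ sym) eq-v eq-u

/-%-injective : ∀ {a b} n .{{_ : NonZero n}} → a / n ≡ b / n → a % n ≡ b % n → a ≡ b
/-%-injective {a} {b} n eq/ eq% = trans (m≡m%n+[m/n]*n a n)
  (trans (cong₂ (λ r q → r + q * n) eq% eq/) (sym (m≡m%n+[m/n]*n b n)))

-- In use, `s i` is the right end of edge `i`, so these are two distinct edges whose right ends lie
-- in one group of `w`.
SameBlock : ∀ {m} → (Fin m → ℕ) → (w : ℕ) .{{_ : NonZero w}} → Fin m → Fin m → Set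
SameBlock s w i j = ¬ i ≡ j × s i / w ≡ s j / w

sameBlock? : ∀ {m} (s : Fin m → ℕ) w .{{_ : NonZero w}} i j → Dec (SameBlock s w i j)
sameBlock? s w i j = ¬? (i Fin.≟ j) ×-dec (s i / w ≟ s j / w)

sameSegment? : ∀ {m} H .{{_ : NonZero H}} (i j : Fin m) → Dec (toℕ i / H ≡ toℕ j / H)
sameSegment? H i j = toℕ i / H ≟ toℕ j / H

-- Ordered pairs of edges that are close at both ends. Their left vertices move in parallel, so
-- averaging over the shifts gives only a weaker bound for them.
closePairs : ∀ {m} → (Fin m → ℕ) → (w H : ℕ) .{{_ : NonZero w}} .{{_ : NonZero H}} → ℕ
closePairs {m} s w H =
  ∑ (allFin m) λ i → ∑ (allFin m) λ j → 𝟙 (sameBlock? s w i j) * 𝟙 (sameSegment? H i j)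

-- Inside one block, `s j` is determined by its remainder modulo `w`.
sameBlock-count : ∀ {m} (s : Fin m → ℕ) → (∀ {i j} → s i ≡ s j → i ≡ j) → ∀ w .{{_ : NonZero w}} i →
                  ∑ (allFin m) (λ j → 𝟙 (sameBlock? s w i j)) ≤ w
sameBlock-count {m} s s-injective w i = count-≤ (sameBlock? s w i) w (λ j → s j % w) (Uniq.allFin⁺ m)
  (λ {j} _ → m%n<n (s j) w)
  (λ (_ , p) (_ , q) eq → s-injective (/-%-injective w (trans (sym p) q) eq))

-- A line in the segment number `toℕ i / H`: the intercept `t` translates all left vertices, and the
-- slope `l` opens equal gaps between consecutive segments of length `H`.
row : ∀ {m} (H : ℕ) .{{_ : NonZero H}} → ℕ → ℕ → Fin m → ℕ
row H t l i = toℕ i + (t + l * (toℕ i / H))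

-- The matrix `blue` enters only through its row and column sums. Shifts `(t, l)` move the rows,
-- slides `k` move the columns.
module Placement
  {m : ℕ} (s : Fin m → ℕ) (s-injective : ∀ {i j} → s i ≡ s j → i ≡ j)
  (w H : ℕ) .{{_ : NonZero w}} .{{_ : NonZero H}}
  (T Λ D N : ℕ) (slot : ℕ → ℕ)
  (blue : ℕ → ℕ → ℕ)
  (row-degree : ∀ {r} → r < N → ∑ (upTo N) (blue r) ≤ D)
  (column-degree : ∀ {c} → c < N → ∑ (upTo N) (λ r → blue r c) ≤ D)
  (row-bound : ∀ {t l} (i : Fin m) → t < T → l < Λ → row H t l i < N)
  (slot-bound : ∀ i {k} → k < D + D → slot (s i) + k < N)
  where

  S : ℕ
  S = D + D

  shifts : List (ℕ × ℕ)
  shifts = cartesianProduct (upTo T) (upTo Λ)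

  cell : Fin m → ℕ → ℕ × ℕ → ℕ
  cell i k (t , l) = blue (row H t l i) (slot (s i) + k)

  blocked : Fin m → ℕ × ℕ → ℕ
  blocked i z = ∑ (upTo S) λ k → cell i k z

  row<N : ∀ i {t l} → (t , l) ∈ shifts → row H t l i < N
  row<N i z∈ = let t∈ , l∈ = ∈-cartesianProduct⁻ (upTo T) (upTo Λ) z∈
               in row-bound i (∈-upTo⁻ t∈) (∈-upTo⁻ l∈)

  blocked≤D : ∀ i {z} → z ∈ shifts → blocked i z ≤ D
  blocked≤D i {t , l} z∈ = ≤-trans
    (∑-injection (slot (s i) +_) (blue (row H t l i)) (Uniq.upTo⁺ S)
      (λ k∈ → ∈-upTo⁺ (slot-bound i (∈-upTo⁻ k∈)))
      (λ _ _ → +-cancelˡ-≡ (slot (s i)) _ _))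
    (row-degree (row<N i z∈))

  -- For a fixed slide and slope `l`, varying `t` runs down a single column through distinct rows,
  -- so each of the `S * Λ` choices contributes at most `D`.
  ∑-blocked : ∀ i → ∑ shifts (blocked i) ≤ S * (Λ * D)
  ∑-blocked i = begin
    ∑ shifts (blocked i)
      ≡⟨ ∑-swap shifts (upTo S) (λ z k → cell i k z) ⟩
    ∑ (upTo S) (λ k → ∑ shifts (cell i k))
      ≡⟨ ∑-cong (upTo S) (λ k → trans (∑-× (upTo T) (upTo Λ) (cell i k)) (∑-swap (upTo T) (upTo Λ) _)) ⟩
    ∑ (upTo S) (λ k → ∑ (upTo Λ) λ l → ∑ (upTo T) λ t → cell i k (t , l))
      ≤⟨ ∑-≤-length (upTo S) (λ k∈ → ∑-≤-length (upTo Λ) (λ l∈ → ≤-trans (along-t (∈-upTo⁻ l∈)) (column-degree (slot-bound i (∈-upTo⁻ k∈))))) ⟩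
    length (upTo S) * (length (upTo Λ) * D)
      ≡⟨ cong₂ (λ a b → a * (b * D)) (length-upTo S) (length-upTo Λ) ⟩
    S * (Λ * D) ∎
    where
    open ≤-Reasoning
    along-t : ∀ {l c} → l < Λ → ∑ (upTo T) (λ t → blue (row H t l i) c) ≤ ∑ (upTo N) (λ r → blue r c)
    along-t {l} {c} l<Λ = ∑-injection (λ t → row H t l i) (λ r → blue r c) (Uniq.upTo⁺ T)
      (λ t∈ → ∈-upTo⁺ (row-bound i (∈-upTo⁻ t∈) l<Λ))
      (λ _ _ eq → +-cancelʳ-≡ _ _ _ (+-cancelˡ-≡ (toℕ i) _ _ eq))

  -- Within one segment the rows of `i` and `j` keep a constant distance and are not independent, so
  -- one factor is simply bounded by `D`.
  pair-same-segment : ∀ i j → ∑ shifts (λ z → blocked i z * blocked j z) ≤ S * (Λ * D) * D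
  pair-same-segment i j = begin
    ∑ shifts (λ z → blocked i z * blocked j z) ≤⟨ ∑-mono shifts (λ {z} z∈ → *-monoʳ-≤ (blocked i z) (blocked≤D j z∈)) ⟩
    ∑ shifts (λ z → blocked i z * D)           ≡⟨ ∑-*ʳ shifts D (blocked i) ⟩
    ∑ shifts (blocked i) * D                   ≤⟨ *-monoˡ-≤ D (∑-blocked i) ⟩
    S * (Λ * D) * D                            ∎
    where open ≤-Reasoning

  -- For fixed columns, `(t, l)` is recovered from the rows of `i` and `j`, so the sum over shifts
  -- embeds in a sum over all pairs of rows, which factors into two column sums. There are `S * S`
  -- pairs of slides.
  pair-other-segment : ∀ i j → ¬ toℕ i / H ≡ toℕ j / H →
                       ∑ shifts (λ z → blocked i z * blocked j z) ≤ S * (S * (D * D))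
  pair-other-segment i j i≁j = begin
    ∑ shifts (λ z → blocked i z * blocked j z)
      ≡⟨ ∑-cong shifts (λ z → ∑-product (upTo S) (upTo S) (λ k → cell i k z) (λ k → cell j k z)) ⟨
    ∑ shifts (λ z → ∑ (upTo S) λ k → ∑ (upTo S) λ k′ → cell i k z * cell j k′ z)
      ≡⟨ ∑-swap shifts (upTo S) _ ⟩
    ∑ (upTo S) (λ k → ∑ shifts λ z → ∑ (upTo S) λ k′ → cell i k z * cell j k′ z)
      ≡⟨ ∑-cong (upTo S) (λ k → ∑-swap shifts (upTo S) _) ⟩
    ∑ (upTo S) (λ k → ∑ (upTo S) λ k′ → ∑ shifts λ z → cell i k z * cell j k′ z)
      ≤⟨ ∑-≤-length (upTo S) (λ k∈ → ∑-≤-length (upTo S) (λ k′∈ →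
           two-cells (slot-bound i (∈-upTo⁻ k∈)) (slot-bound j (∈-upTo⁻ k′∈)))) ⟩
    length (upTo S) * (length (upTo S) * (D * D))
      ≡⟨ cong (λ n → n * (n * (D * D))) (length-upTo S) ⟩
    S * (S * (D * D)) ∎
    where
    open ≤-Reasoning
    two-rows : ℕ × ℕ → ℕ × ℕ
    two-rows (t , l) = row H t l i , row H t l j
    two-cells : ∀ {c d} → c < N → d < N →
                ∑ shifts (λ (t , l) → blue (row H t l i) c * blue (row H t l j) d) ≤ D * D
    two-cells {c} {d} c<N d<N = begin
      ∑ shifts (λ (t , l) → blue (row H t l i) c * blue (row H t l j) d)
        ≤⟨ ∑-injection two-rows (λ (r , r′) → blue r c * blue r′ d)
             (Uniq.cartesianProduct⁺ (Uniq.upTo⁺ T) (Uniq.upTo⁺ Λ))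
             (λ z∈ → ∈-cartesianProduct⁺ (∈-upTo⁺ (row<N i z∈)) (∈-upTo⁺ (row<N j z∈)))
             (λ _ _ eq → let t≡ , l≡ = lines-meet-once (+-cancelˡ-≡ (toℕ i) _ _ (cong proj₁ eq))
                                                        (+-cancelˡ-≡ (toℕ j) _ _ (cong proj₂ eq)) i≁j
                         in cong₂ _,_ t≡ l≡) ⟩
      ∑ (cartesianProduct (upTo N) (upTo N)) (λ (r , r′) → blue r c * blue r′ d)
        ≡⟨ trans (∑-× (upTo N) (upTo N) _) (∑-product (upTo N) (upTo N) (λ r → blue r c) (λ r → blue r d)) ⟩
      ∑ (upTo N) (λ r → blue r c) * ∑ (upTo N) (λ r → blue r d)
        ≤⟨ *-mono-≤ (column-degree c<N) (column-degree d<N) ⟩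
      D * D ∎

  near : Fin m → Fin m → ℕ
  near i j = 𝟙 (sameBlock? s w i j)

  weight : ℕ × ℕ → ℕ
  weight z = ∑ (allFin m) λ i → ∑ (allFin m) λ j → near i j * (blocked i z * blocked j z)

  pair : ∀ i j (d : Dec (toℕ i / H ≡ toℕ j / H)) → ∑ shifts (λ z → blocked i z * blocked j z) ≤
                 S * (S * (D * D)) + 𝟙 d * (S * (Λ * D) * D)
  pair i j (yes _)  = ≤-trans (pair-same-segment i j) (≤-trans (≤-reflexive (sym (+-identityʳ _))) (m≤n+m _ (S * (S * (D * D)))))
  pair i j (no i≁j) = ≤-trans (pair-other-segment i j i≁j) (m≤m+n _ _)

  ∑-near : ∑ (allFin m) (λ i → ∑ (allFin m) (near i)) ≤ m * w
  ∑-near = ≤-trans (∑-≤-length (allFin m) (λ {i} _ → sameBlock-count s s-injective w i))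
                   (≤-reflexive (cong (_* w) (length-allFin m)))

  -- Every pair in a common block is charged the bound for different segments, and a close pair
  -- additionally the bound for one segment.
  ∑-weight : ∑ shifts weight ≤ (m * w) * (S * (S * (D * D))) + closePairs s w H * (S * (Λ * D) * D)
  ∑-weight = begin
    ∑ shifts weight
      ≡⟨ ∑-swap shifts (allFin m) _ ⟩
    ∑ (allFin m) (λ i → ∑ shifts λ z → ∑ (allFin m) λ j → near i j * (blocked i z * blocked j z))
      ≡⟨ ∑-cong (allFin m) (λ i → trans (∑-swap shifts (allFin m) _)
           (∑-cong (allFin m) (λ j → ∑-*ˡ shifts (near i j) _))) ⟩
    ∑ (allFin m) (λ i → ∑ (allFin m) λ j → near i j * ∑ shifts (λ z → blocked i z * blocked j z))
      ≤⟨ ∑-mono (allFin m) (λ {i} _ → ∑-mono (allFin m) (λ {j} _ → *-monoʳ-≤ (near i j) (pair i j (sameSegment? H i j)))) ⟩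
    ∑ (allFin m) (λ i → ∑ (allFin m) λ j → near i j * (X + close i j * Y))
      ≡⟨ ∑-cong (allFin m) (λ i → trans (∑-cong (allFin m) (λ j → split i j)) (∑-+ (allFin m) _ _)) ⟩
    ∑ (allFin m) (λ i → ∑ (allFin m) (λ j → near i j * X) + ∑ (allFin m) (λ j → near i j * close i j * Y))
      ≡⟨ ∑-+ (allFin m) _ _ ⟩
    ∑ (allFin m) (λ i → ∑ (allFin m) λ j → near i j * X) + ∑ (allFin m) (λ i → ∑ (allFin m) λ j → near i j * close i j * Y)
      ≡⟨ cong₂ _+_ (pull X near) (pull Y (λ i j → near i j * close i j)) ⟩
    ∑ (allFin m) (λ i → ∑ (allFin m) (near i)) * X + closePairs s w H * Y
      ≤⟨ +-monoˡ-≤ _ (*-monoˡ-≤ X ∑-near) ⟩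
    m * w * X + closePairs s w H * Y ∎
    where
    open ≤-Reasoning
    X = S * (S * (D * D))
    Y = S * (Λ * D) * D
    close : Fin m → Fin m → ℕ
    close i j = 𝟙 (sameSegment? H i j)
    split : ∀ i j → near i j * (X + close i j * Y) ≡ near i j * X + near i j * close i j * Y
    split i j = trans (*-distribˡ-+ (near i j) X _) (cong (near i j * X +_) (sym (*-assoc (near i j) _ Y)))
    pull : ∀ c (f : Fin m → Fin m → ℕ) →
           ∑ (allFin m) (λ i → ∑ (allFin m) λ j → f i j * c) ≡ ∑ (allFin m) (λ i → ∑ (allFin m) (f i)) * c
    pull c f = trans (∑-cong (allFin m) (λ i → ∑-*ʳ (allFin m) c (f i))) (∑-*ʳ (allFin m) c _)

  Free : ℕ → ℕ → ℕ → Set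
  Free t l g = ∃ λ k → k < S × (∀ i → s i / w ≡ g → blue (row H t l i) (slot (s i) + k) ≡ 0)

  -- If every slide were hit, the `blocked` values of the group would add up to at least
  -- `S = D + D`. As each is at most `D`, those other than `i` would still give at least `D`, so the
  -- products over pairs in the group would add up to at least `S * D`.
  free-shift : ∀ {t l} → (t , l) ∈ shifts → weight (t , l) < S * D → ∀ g → Free t l g
  free-shift {t} {l} z∈ light g = find (all-hit <? length (upTo S) * 1)
    where
    open ≤-Reasoning
    z : ℕ × ℕ
    z = t , l
    inGroup : Fin m → ℕ
    inGroup i = 𝟙 (s i / w ≟ g)
    hits : ℕ → ℕ
    hits k = ∑ (allFin m) λ i → inGroup i * cell i k z
    all-hit : ℕ
    all-hit = ∑ (upTo S) hits
    groupBlocked : ℕ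
    groupBlocked = ∑ (allFin m) λ i → inGroup i * blocked i z
    all-hit≡ : all-hit ≡ groupBlocked
    all-hit≡ = trans (∑-swap (upTo S) (allFin m) _) (∑-cong (allFin m) (λ i → ∑-*ˡ (upTo S) (inGroup i) _))
    others : ∀ i → s i / w ≡ g → groupBlocked ≤ ∑ (allFin m) (λ j → near i j * blocked j z) + blocked i z
    others i i∈g = begin
      groupBlocked
        ≤⟨ ∑-mono (allFin m) (λ {j} _ → term j) ⟩
      ∑ (allFin m) (λ j → near i j * blocked j z + 𝟙 (j Fin.≟ i) * blocked j z)
        ≡⟨ ∑-+ (allFin m) _ _ ⟩
      ∑ (allFin m) (λ j → near i j * blocked j z) + ∑ (allFin m) (λ j → 𝟙 (j Fin.≟ i) * blocked j z)
        ≤⟨ +-monoʳ-≤ _ (∑-δ (Fin._≟ i) i (λ j → blocked j z) (Uniq.allFin⁺ m) (λ eq → eq)) ⟩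
      ∑ (allFin m) (λ j → near i j * blocked j z) + blocked i z ∎
      where
      term : ∀ j → inGroup j * blocked j z ≤ near i j * blocked j z + 𝟙 (j Fin.≟ i) * blocked j z
      term j = ≤-trans (*-monoˡ-≤ (blocked j z) (𝟙-cover (s j / w ≟ g) (sameBlock? s w i j) (j Fin.≟ i) cover))
                       (≤-reflexive (*-distribʳ-+ (blocked j z) (near i j) _))
        where
        cover : s j / w ≡ g → SameBlock s w i j ⊎ j ≡ i
        cover j∈g with j Fin.≟ i
        ... | yes j≡i = inj₂ j≡i
        ... | no  j≢i = inj₁ ((λ i≡j → j≢i (sym i≡j)) , trans i∈g (sym j∈g))
    find : Dec (all-hit < length (upTo S) * 1) → Free t l g
    -- By averaging, some slide has fewer than one hit, hence none. The factor `1` is the bound `c`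
    -- of `∑-pigeonhole`.
    find (yes lt) with ∑-pigeonhole (upTo S) hits 1 lt
    ... | k , k∈ , hits<1 = k , ∈-upTo⁻ k∈ , λ i i∈g → n<1⇒n≡0 (≤-<-trans (only i i∈g) hits<1)
      where
      only : ∀ i → s i / w ≡ g → cell i k z ≤ hits k
      only i i∈g = begin
        cell i k z             ≡⟨ *-identityˡ _ ⟨
        1 * cell i k z         ≡⟨ cong (_* cell i k z) (𝟙-yes (s i / w ≟ g) i∈g) ⟨
        inGroup i * cell i k z ≤⟨ ∑-∈ (λ i → inGroup i * cell i k z) (∈-allFin i) ⟩
        hits k                 ∎
    find (no ≮) = contradiction light (≤⇒≯ (begin
      S * D
        ≤⟨ *-monoˡ-≤ D S≤ ⟩
      groupBlocked * D
        ≡⟨ ∑-*ʳ (allFin m) D _ ⟨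
      ∑ (allFin m) (λ i → inGroup i * blocked i z * D)
        ≤⟨ ∑-mono (allFin m) (λ {i} _ → heavy i) ⟩
      ∑ (allFin m) (λ i → blocked i z * ∑ (allFin m) (λ j → near i j * blocked j z))
        ≡⟨ ∑-cong (allFin m) (λ i → trans (sym (∑-*ˡ (allFin m) (blocked i z) _)) (∑-cong (allFin m) (λ j → reorder i j))) ⟩
      weight z ∎))
      where
      S≤ : S ≤ groupBlocked
      S≤ = begin
        S                   ≡⟨ length-upTo S ⟨
        length (upTo S)     ≡⟨ *-identityʳ _ ⟨
        length (upTo S) * 1 ≤⟨ ≮⇒≥ ≮ ⟩
        all-hit             ≡⟨ all-hit≡ ⟩
        groupBlocked        ∎
      heavy : ∀ i → inGroup i * blocked i z * D ≤ blocked i z * ∑ (allFin m) (λ j → near i j * blocked j z)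
      heavy i = ≤-trans (≤-reflexive (*-assoc (inGroup i) _ D)) (𝟙-*-≤ (s i / w ≟ g) λ i∈g →
        *-monoʳ-≤ (blocked i z) (+-cancelʳ-≤ D _ _
          (≤-trans S≤ (≤-trans (others i i∈g) (+-monoʳ-≤ _ (blocked≤D i z∈))))))
      reorder : ∀ i j → blocked i z * (near i j * blocked j z) ≡ near i j * (blocked i z * blocked j z)
      reorder i j = trans (sym (*-assoc (blocked i z) (near i j) _))
        (trans (cong (_* blocked j z) (*-comm (blocked i z) (near i j))) (*-assoc (near i j) _ _))

  -- The hypothesis puts the average of `weight` over the `T * Λ` shifts below `S * D`. Since
  -- `weight` sums over all groups, one light shift serves every group, each with its own slide.
  placement : (m * w) * (S * (S * (D * D))) + closePairs s w H * (S * (Λ * D) * D) < T * Λ * (S * D) →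
              ∃₂ λ t l → t < T × l < Λ × (∀ g → Free t l g)
  placement lt with ∑-pigeonhole shifts weight (S * D) (≤-<-trans ∑-weight (<-≤-trans lt (≤-reflexive
    (cong (_* (S * D)) (sym (trans (length-cartesianProductWith _,_ (upTo T) (upTo Λ)) (cong₂ _*_ (length-upTo T) (length-upTo Λ))))))))
  ... | (t , l) , z∈ , light =
    let t∈ , l∈ = ∈-cartesianProduct⁻ (upTo T) (upTo Λ) z∈
    in t , l , ∈-upTo⁻ t∈ , ∈-upTo⁻ l∈ , free-shift z∈ light

-- Random matchings

prepend : ∀ {m} → Fin (suc m) → Vec (Fin m) m → Vec (Fin (suc m)) (suc m)
prepend x v = x ∷ Vec.map (punchIn x) v

perms : ∀ m → List (Vec (Fin m) m)
perms zero    = [] ∷ []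
perms (suc m) = cartesianProductWith prepend (allFin (suc m)) (perms m)

length-perms : ∀ m → length (perms m) ≡ m !
length-perms zero    = refl
length-perms (suc m) = trans (length-cartesianProductWith prepend (allFin (suc m)) (perms m))
  (cong₂ _*_ (length-allFin (suc m)) (length-perms m))

Vec-map-injective : ∀ {n} {f : A → B} → (∀ {x y} → f x ≡ f y → x ≡ y) →
                    {u v : Vec A n} → Vec.map f u ≡ Vec.map f v → u ≡ v
Vec-map-injective f-inj {[]}    {[]}    _  = refl
Vec-map-injective f-inj {_ ∷ _} {_ ∷ _} eq =
  let x≡y , u≡v = ∷-injective eq in cong₂ _∷_ (f-inj x≡y) (Vec-map-injective f-inj u≡v)

perms-unique : ∀ m → Unique (perms m)
perms-unique zero    = All.[] ∷ []
perms-unique (suc m) = Uniq.cartesianProductWith⁺ prepend prepend-injective (Uniq.allFin⁺ (suc m)) (perms-unique m)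
  where
  prepend-injective : ∀ {x y v u} → prepend x v ≡ prepend y u → x ≡ y × v ≡ u
  prepend-injective {x} eq with ∷-injective eq
  ... | refl , eq′ = refl , Vec-map-injective (punchIn-injective x _ _) eq′

perms-sound : ∀ m {v} → v ∈ perms m → IsPerm v
perms-sound zero    _ ()
perms-sound (suc m) v∈ with ∈-cartesianProductWith⁻ prepend (allFin (suc m)) (perms m) v∈
... | x , u , _ , u∈ , refl = injective
  where
  injective : IsPerm (prepend x u)
  injective zero    zero    _  = refl
  injective zero    (suc j) eq = contradiction (sym (trans eq (lookup-map j (punchIn x) u))) (punchInᵢ≢i x _)
  injective (suc i) zero    eq = contradiction (trans (sym (lookup-map i (punchIn x) u)) eq) (punchInᵢ≢i x _)
  injective (suc i) (suc j) eq = cong suc (perms-sound m u∈ i j (punchIn-injective x _ _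
    (trans (sym (lookup-map i (punchIn x) u)) (trans eq (lookup-map j (punchIn x) u)))))

-- Deleting the first value `x` with `punchOut` leaves a permutation of one size less, which
-- `punchIn x` restores.
perms-complete : ∀ m {v : Vec (Fin m) m} → IsPerm v → v ∈ perms m
perms-complete zero    {[]}    _      = here refl
perms-complete (suc m) {x ∷ v} inj =
  subst (λ u → x ∷ u ∈ perms (suc m)) restored
    (∈-cartesianProductWith⁺ prepend (∈-allFin x) (perms-complete m rest-perm))
  where
  x≢ : ∀ i → ¬ x ≡ lookup v i
  x≢ i eq = contradiction (inj zero (suc i) eq) λ ()
  rest : Vec (Fin m) m
  rest = tabulate (λ i → punchOut (x≢ i))
  rest-perm : IsPerm rest
  rest-perm i j eq = Fin.suc-injective (inj (suc i) (suc j) (punchOut-injective (x≢ i) (x≢ j)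
    (trans (sym (lookup∘tabulate _ i)) (trans eq (lookup∘tabulate _ j)))))
  restored : Vec.map (punchIn x) rest ≡ v
  restored = trans (sym (tabulate-∘ (punchIn x) _))
    (trans (tabulate-cong (λ i → punchIn-punchOut (x≢ i))) (tabulate∘lookup v))

transpose-right : ∀ {n} (i j : Fin n) → transpose i j j ≡ i
transpose-right i j with j Fin.≟ i
... | yes j≡i = j≡i
... | no  _ with j Fin.≟ j
...   | yes _  = refl
...   | no j≢j = contradiction refl j≢j

transpose-fixes : ∀ {n} {i j k : Fin n} → ¬ k ≡ i → ¬ k ≡ j → transpose i j k ≡ k
transpose-fixes {i = i} {j} {k} k≢i k≢j with k Fin.≟ i
... | yes eq = contradiction eq k≢i
... | no  _ with k Fin.≟ j
...   | yes eq = contradiction eq k≢j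
...   | no  _  = refl

swap : ∀ {m} → Fin m → Fin m → Vec (Fin m) m → Vec (Fin m) m
swap i j v = tabulate (lookup v ∘ transpose i j)

swap-swap : ∀ {m} (i j : Fin m) v → swap j i (swap i j v) ≡ v
swap-swap i j v = trans (tabulate-cong λ k → trans (lookup∘tabulate _ (transpose j i k)) (cong (lookup v) (transpose-inverse i j)))
                        (tabulate∘lookup v)

swap-perm : ∀ {m} (i j : Fin m) {v} → IsPerm v → IsPerm (swap i j v)
swap-perm i j {v} inj a b eq = trans (sym (transpose-inverse j i)) (trans (cong (transpose j i)
  (inj _ _ (trans (sym (lookup∘tabulate _ a)) (trans eq (lookup∘tabulate _ b))))) (transpose-inverse j i))

-- Close pairs in a random permutation

values : ∀ {m} → Vec (Fin m) m → Fin m → ℕ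
values v i = toℕ (lookup v i)

module _ (m w H : ℕ) .{{_ : NonZero w}} .{{_ : NonZero H}} where

  shared : Vec (Fin m) m → Fin m → Fin m → ℕ
  shared v i j = 𝟙 (sameBlock? (values v) w i j)

  sharedTotal : Fin m → Fin m → ℕ
  sharedTotal i j = ∑ (perms m) λ v → shared v i j

  -- Exchanging the values at `j` and `k` is an injection on permutations that turns a block shared
  -- by `i` and `j` into one shared by `i` and `k`.
  sharedTotal-symmetric : ∀ i {j k} → ¬ i ≡ j → ¬ i ≡ k → sharedTotal i j ≤ sharedTotal i k
  sharedTotal-symmetric i {j} {k} i≢j i≢k = ≤-trans
    (≤-reflexive (∑-cong (perms m) (λ v → moved v)))
    (∑-injection (swap j k) (λ v → shared v i k) (perms-unique m)
       (λ {v} v∈ → perms-complete m (swap-perm j k {v} (perms-sound m v∈)))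
       (λ {u} {v} _ _ eq → trans (sym (swap-swap j k u)) (trans (cong (swap k j) eq) (swap-swap j k v))))
    where
    moved : ∀ v → shared v i j ≡ shared (swap j k v) i k
    moved v with i Fin.≟ j | i Fin.≟ k
    ... | yes eq | _      = contradiction eq i≢j
    ... | no _   | yes eq = contradiction eq i≢k
    ... | no _   | no _   = cong₂ (λ a b → 𝟙 (toℕ a / w ≟ toℕ b / w))
      (sym (trans (lookup∘tabulate _ i) (cong (lookup v) (transpose-fixes i≢j i≢k))))
      (sym (trans (lookup∘tabulate _ k) (cong (lookup v) (transpose-right j k))))

  shared-count : ∀ {v} → v ∈ perms m → ∀ i → ∑ (allFin m) (shared v i) ≤ w
  shared-count {v} v∈ = sameBlock-count (values v) (λ eq → perms-sound m v∈ _ _ (toℕ-injective eq)) w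

  ∑-sharedTotal : ∀ i → ∑ (allFin m) (sharedTotal i) ≤ m ! * w
  ∑-sharedTotal i = begin
    ∑ (allFin m) (sharedTotal i)                      ≡⟨ ∑-swap (allFin m) (perms m) _ ⟩
    ∑ (perms m) (λ v → ∑ (allFin m) (shared v i))    ≤⟨ ∑-≤-length (perms m) (λ v∈ → shared-count v∈ i) ⟩
    length (perms m) * w                           ≡⟨ cong (_* w) (length-perms m) ⟩
    m ! * w                                        ∎
    where open ≤-Reasoning

  others : ∀ i → m ≤ suc (∑ (allFin m) λ k → 𝟙 (¬? (i Fin.≟ k)))
  others i = begin
    m
      ≡⟨ trans (∑-const (allFin m) 1) (trans (*-identityʳ _) (length-allFin m)) ⟨
    ∑ (allFin m) (λ _ → 1)
      -- `yes tt` writes the constant 1 as an indicator, so that `𝟙-cover` applies.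
      ≤⟨ ∑-mono (allFin m) (λ {k} _ → 𝟙-cover (yes tt) (¬? (i Fin.≟ k)) (k Fin.≟ i) (λ _ → dichotomy k)) ⟩
    ∑ (allFin m) (λ k → 𝟙 (¬? (i Fin.≟ k)) + 𝟙 (k Fin.≟ i))
      ≡⟨ ∑-+ (allFin m) _ _ ⟩
    ∑ (allFin m) (λ k → 𝟙 (¬? (i Fin.≟ k))) + ∑ (allFin m) (λ k → 𝟙 (k Fin.≟ i))
      ≤⟨ +-monoʳ-≤ _ (count-≤ (Fin._≟ i) 1 (λ _ → 0) (Uniq.allFin⁺ m) (λ _ → s≤s z≤n) (λ p q _ → trans p (sym q))) ⟩
    ∑ (allFin m) (λ k → 𝟙 (¬? (i Fin.≟ k))) + 1
      ≡⟨ +-comm _ 1 ⟩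
    suc (∑ (allFin m) λ k → 𝟙 (¬? (i Fin.≟ k))) ∎
    where
    open ≤-Reasoning
    dichotomy : ∀ k → ¬ i ≡ k ⊎ k ≡ i
    dichotomy k with k Fin.≟ i
    ... | yes eq = inj₂ eq
    ... | no  ne = inj₁ (ne ∘ sym)

  -- The probability bound `w / (m - 1)` cleared of denominators. For `i ≠ j`, symmetry makes the
  -- totals of all `m - 1` indices other than `i` at least `sharedTotal i j`, and together they are
  -- at most `m ! * w`. For `i = j` the total is zero.
  sharedTotal-≤ : ∀ i j → pred m * sharedTotal i j ≤ m ! * w
  sharedTotal-≤ i j = bound (i Fin.≟ j)
    where
    open ≤-Reasoning
    bound : Dec (i ≡ j) → pred m * sharedTotal i j ≤ m ! * w
    bound (yes i≡j) = ≤-trans (*-monoʳ-≤ (pred m) none) (≤-trans (≤-reflexive (*-zeroʳ (pred m))) z≤n)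
      where
      none : sharedTotal i j ≤ 0
      none = ≤-trans (∑-≤-length (perms m) {c = 0} (λ {v} _ → ≤-trans (≤-reflexive (sym (*-identityʳ _)))
               (𝟙-*-≤ (sameBlock? (values v) w i j) (λ (i≢j , _) → contradiction i≡j i≢j))))
               (≤-reflexive (*-zeroʳ (length (perms m))))
    bound (no i≢j) = begin
      pred m * sharedTotal i j
        ≤⟨ *-monoˡ-≤ (sharedTotal i j) (pred-mono-≤ (others i)) ⟩
      ∑ (allFin m) (λ k → 𝟙 (¬? (i Fin.≟ k))) * sharedTotal i j
        ≡⟨ ∑-*ʳ (allFin m) (sharedTotal i j) _ ⟨
      ∑ (allFin m) (λ k → 𝟙 (¬? (i Fin.≟ k)) * sharedTotal i j)
        ≤⟨ ∑-mono (allFin m) (λ {k} _ → 𝟙-*-≤ (¬? (i Fin.≟ k)) (sharedTotal-symmetric i i≢j)) ⟩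
      ∑ (allFin m) (sharedTotal i)
        ≤⟨ ∑-sharedTotal i ⟩
      m ! * w ∎

  sameSegment-count : ∀ i → ∑ (allFin m) (λ j → 𝟙 (sameSegment? H i j)) ≤ H
  sameSegment-count i = count-≤ (sameSegment? H i) H (λ j → toℕ j % H) (Uniq.allFin⁺ m)
    (λ {j} _ → m%n<n (toℕ j) H) (λ p q eq → toℕ-injective (/-%-injective H (trans (sym p) q) eq))

  -- Linearity of expectation: at most `m * H` ordered pairs lie in a common segment, and each
  -- shares a block with probability at most `w / (m - 1)`.
  ∑-closePairs : pred m * ∑ (perms m) (λ v → closePairs (values v) w H) ≤ m * H * (m ! * w)
  ∑-closePairs = begin
    pred m * ∑ (perms m) (λ v → closePairs (values v) w H)
      ≡⟨ cong (pred m *_) (trans (∑-swap (perms m) (allFin m) _) (∑-cong (allFin m) (λ i →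
           trans (∑-swap (perms m) (allFin m) _) (∑-cong (allFin m) (λ j → ∑-*ʳ (perms m) (close i j) _))))) ⟩
    pred m * ∑ (allFin m) (λ i → ∑ (allFin m) λ j → sharedTotal i j * close i j)
      ≡⟨ trans (∑-cong (allFin m) (λ i → ∑-*ˡ (allFin m) (pred m) _)) (∑-*ˡ (allFin m) (pred m) _) ⟨
    ∑ (allFin m) (λ i → ∑ (allFin m) λ j → pred m * (sharedTotal i j * close i j))
      ≤⟨ ∑-mono (allFin m) (λ {i} _ → ∑-mono (allFin m) (λ {j} _ →
           ≤-trans (≤-reflexive (sym (*-assoc (pred m) _ _))) (*-monoˡ-≤ (close i j) (sharedTotal-≤ i j)))) ⟩
    ∑ (allFin m) (λ i → ∑ (allFin m) λ j → (m ! * w) * close i j)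
      ≡⟨ ∑-cong (allFin m) (λ i → ∑-*ˡ (allFin m) (m ! * w) _) ⟩
    ∑ (allFin m) (λ i → (m ! * w) * ∑ (allFin m) (close i))
      ≤⟨ ∑-≤-length (allFin m) (λ {i} _ → *-monoʳ-≤ (m ! * w) (sameSegment-count i)) ⟩
    length (allFin m) * (m ! * w * H)
      ≡⟨ cong₂ _*_ (length-allFin m) (*-comm (m ! * w) H) ⟩
    m * (H * (m ! * w))
      ≡⟨ *-assoc m H _ ⟨
    m * H * (m ! * w) ∎
    where
    open ≤-Reasoning
    close : Fin m → Fin m → ℕ
    close i j = 𝟙 (sameSegment? H i j)

-- Markov's inequality without division: an element that fails the test pays for `c` by its own
-- value.
markov : ∀ (xs : List A) (f : A → ℕ) c → length xs * c ≤ length (filter (λ x → f x ≤? c) xs) * c + ∑ xs f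
markov xs f c = begin
  length xs * c
    ≡⟨ ∑-const xs c ⟨
  ∑ xs (λ _ → c)
    ≤⟨ ∑-mono xs (λ {x} _ → term x (f x ≤? c)) ⟩
  ∑ xs (λ x → 𝟙 (f x ≤? c) * c + f x)
    ≡⟨ ∑-+ xs _ f ⟩
  ∑ xs (λ x → 𝟙 (f x ≤? c) * c) + ∑ xs f
    ≡⟨ cong (_+ ∑ xs f) (trans (∑-*ʳ xs c _) (cong (_* c) (∑-𝟙 (λ x → f x ≤? c) xs))) ⟩
  length (filter (λ x → f x ≤? c) xs) * c + ∑ xs f ∎
  where
  open ≤-Reasoning
  term : ∀ x (d : Dec (f x ≤ c)) → c ≤ 𝟙 d * c + f x
  term x (yes _)  = ≤-trans (m≤m+n c 0) (m≤m+n (c + 0) (f x))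
  term x (no f≰c) = <⇒≤ (≰⇒> f≰c)

sparsePerms : ∀ (m w H K : ℕ) .{{_ : NonZero w}} .{{_ : NonZero H}} → List (Vec (Fin m) m)
sparsePerms m w H K = filter (λ v → closePairs (values v) w H ≤? K) (perms m)

-- The mean of `closePairs` is at most `m * H * w / (m - 1)`, hence at most `2 * H * w`. By Markov's
-- inequality at most a share `1 / q` of the permutations exceeds `q` times that.
sparsePerms-many : ∀ m w H q .{{_ : NonZero w}} .{{_ : NonZero H}} → 2 ≤ m →
                   q * m ! ≤ q * length (sparsePerms m w H (q * (2 * (H * w)))) + m !
sparsePerms-many m w H q 2≤m = *-cancelʳ-≤ _ _ (pred m * (2 * (H * w)))
  {{m*n≢0 (pred m) (2 * (H * w)) {{>-nonZero (pred-mono-≤ 2≤m)}} {{m*n≢0 2 (H * w) {{_}} {{m*n≢0 H w}}}}}} (begin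
  q * m ! * (pred m * (2 * (H * w)))           ≡⟨ regroup q (m !) (pred m) (2 * (H * w)) ⟩
  pred m * (m ! * K)                           ≡⟨ cong (λ l → pred m * (l * K)) (length-perms m) ⟨
  pred m * (length (perms m) * K)              ≤⟨ *-monoʳ-≤ (pred m) (markov (perms m) (λ v → closePairs (values v) w H) K) ⟩
  pred m * (G * K + total)                     ≡⟨ *-distribˡ-+ (pred m) (G * K) total ⟩
  pred m * (G * K) + pred m * total            ≤⟨ +-monoʳ-≤ (pred m * (G * K)) (∑-closePairs m w H) ⟩
  pred m * (G * K) + m * H * (m ! * w)         ≤⟨ +-monoʳ-≤ (pred m * (G * K)) (*-monoˡ-≤ (m ! * w) (*-monoˡ-≤ H (m≤2[m-1] 2≤m))) ⟩
  pred m * (G * K) + pred m * 2 * H * (m ! * w) ≡⟨ collect q (m !) (pred m) H w G ⟩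
  (q * G + m !) * (pred m * (2 * (H * w)))     ∎)
  where
  open ≤-Reasoning
  K = q * (2 * (H * w))
  G = length (sparsePerms m w H K)
  total = ∑ (perms m) λ v → closePairs (values v) w H
  m≤2[m-1] : ∀ {m} → 2 ≤ m → m ≤ pred m * 2
  m≤2[m-1] {suc (suc n)} _ = s≤s (s≤s (m≤m*n n 2))
  m≤2[m-1] {suc zero} (s≤s ())
  regroup : ∀ q M a b → q * M * (a * b) ≡ a * (M * (q * b))
  regroup = solve-∀
  collect : ∀ q M a H w G → a * (G * (q * (2 * (H * w)))) + a * 2 * H * (M * w) ≡ (q * G + M) * (a * (2 * (H * w)))
  collect = solve-∀

-- Colourings without blue triangles

AllPairs-lookup : ∀ {R : A → A → Set} {xs} → AllPairs R xs → ∀ {i j : Fin (length xs)} → i F.< j →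
                  R (List.lookup xs i) (List.lookup xs j)
AllPairs-lookup (Rx ∷ _)  {zero}  {suc j} _         = All.lookup Rx (∈-lookup j)
AllPairs-lookup (_ ∷ Rxs) {suc i} {suc j} (s≤s i<j) = AllPairs-lookup Rxs i<j

-- Filtering keeps `upTo N` sorted, and the first `n` entries of the result are taken.
increasing-selection : ∀ {P : ℕ → Set} (P? : Decidable P) n N → n ≤ ∑ (upTo N) (λ x → 𝟙 (P? x)) →
                       Σ (Fin n → ℕ) λ φ → (∀ {i j} → i F.< j → φ i < φ j) × (∀ i → φ i < N × P (φ i))
increasing-selection P? n N n≤ = (λ i → List.lookup xs (inject≤ i n≤len)) ,
  (λ {i} {j} i<j → AllPairs-lookup xs-sorted (subst₂ _<_ (sym (toℕ-inject≤ i n≤len)) (sym (toℕ-inject≤ j n≤len)) i<j)) ,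
  (λ i → let x∈ , Px = ∈-filter⁻ P? {xs = upTo N} (∈-lookup (inject≤ i n≤len)) in ∈-upTo⁻ x∈ , Px)
  where
  xs = filter P? (upTo N)
  n≤len : n ≤ length xs
  n≤len = ≤-trans n≤ (≤-reflexive (∑-𝟙 P? (upTo N)))
  xs-sorted : AllPairs _<_ xs
  xs-sorted = AllPairs.filter⁺ P? (AllPairs.applyUpTo⁺₁ id N (λ i<j _ → i<j))

-- Turns local alternatives into a global one: in use, either all degrees are small or a red copy
-- has already been found.
all-or : ∀ {P : ℕ → Set} {X : Set} N → (∀ {n} → n < N → P n ⊎ X) → (∀ {n} → n < N → P n) ⊎ X
all-or zero    f = inj₁ λ ()
all-or (suc N) f with f (n<1+n N) | all-or N (f ∘ m<n⇒m<1+n)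
... | inj₂ x | _      = inj₂ x
... | inj₁ _ | inj₂ x = inj₂ x
... | inj₁ p | inj₁ g = inj₁ λ n<1+N → [ g , (λ { refl → p }) ]′ (m≤n⇒m<n∨m≡n (s≤s⁻¹ n<1+N))

glue : ∀ {m} → (Fin m → ℕ) → (Fin m → ℕ) → Fin (m + m) → ℕ
glue {m} f g x = [ f , g ]′ (splitAt m x)

glue-increasing : ∀ {m} {f g : Fin m → ℕ} →
                  (∀ {i j} → i F.< j → f i < f j) → (∀ {i j} → i F.< j → g i < g j) → (∀ i j → f i < g j) →
                  ∀ {x y} → x F.< y → glue f g x < glue f g y
glue-increasing {m} {f} {g} f↑ g↑ f<g {x} {y} x<y with splitAt m x in eqx | splitAt m y in eqy
... | inj₁ i | inj₁ j = f↑ (subst₂ _<_ (at-left eqx) (at-left eqy) x<y)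
  where
  at-left : ∀ {x i} → splitAt m {m} x ≡ inj₁ i → toℕ x ≡ toℕ i
  at-left {i = i} eq = trans (cong toℕ (sym (splitAt⁻¹-↑ˡ eq))) (toℕ-↑ˡ i m)
... | inj₁ i | inj₂ j = f<g i j
... | inj₂ i | inj₁ j = contradiction x<y (<⇒≯ (subst₂ _<_
    (trans (sym (toℕ-↑ˡ j m)) (cong toℕ (splitAt⁻¹-↑ˡ eqy)))
    (trans (sym (toℕ-↑ʳ m i)) (cong toℕ (splitAt⁻¹-↑ʳ {m} eqx)))
    (<-≤-trans (toℕ<n j) (m≤m+n m (toℕ i)))))
... | inj₂ i | inj₂ j = g↑ (+-cancelˡ-< m _ _ (subst₂ _<_ (at-right eqx) (at-right eqy) x<y))
  where
  at-right : ∀ {x i} → splitAt m {m} x ≡ inj₂ i → toℕ x ≡ m + toℕ i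
  at-right {i = i} eq = trans (cong toℕ (sym (splitAt⁻¹-↑ʳ {m} eq))) (toℕ-↑ʳ m i)

module Coloured {N : ℕ} .{{_ : NonZero N}} (col : Colouring N) where

  -- Positions are natural numbers. Reducing modulo `N` makes the colouring total and changes no
  -- position below `N`.
  colour : ℕ → ℕ → Bool
  colour a b = col (a mod N) (b mod N)

  toℕ-mod : ∀ {a} → a < N → toℕ (a mod N) ≡ a
  toℕ-mod {a} a<N = trans (toℕ-fromℕ< (m%n<n a N)) (m<n⇒m%n≡m a<N)

  mod-< : ∀ {a b} → a < b → b < N → a mod N F.< b mod N
  mod-< a<b b<N = subst₂ _<_ (sym (toℕ-mod (<-trans a<b b<N))) (sym (toℕ-mod b<N)) a<b

  -- The order is part of the relation, because `col` is meaningful only above the diagonal.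
  Blue : ℕ → ℕ → Set
  Blue a b = a < b × colour a b ≡ false

  blue? : ∀ a b → Dec (Blue a b)
  blue? a b = a <? b ×-dec (colour a b Bool.≟ false)

  blue : ℕ → ℕ → ℕ
  blue a b = 𝟙 (blue? a b)

  blue-triangle : ∀ {a b c} → c < N → Blue a b → Blue a c → Blue b c → BlueTriangle col
  blue-triangle {a} {b} {c} c<N (a<b , ab) (_ , ac) (b<c , bc) =
    a mod N , b mod N , c mod N , mod-< a<b (<-trans b<c c<N) , mod-< b<c c<N , ab , ac , bc

  not-blue⇒red : ∀ {a b} → a < b → ¬ Blue a b → colour a b ≡ true
  not-blue⇒red {a} {b} a<b ¬blue with colour a b
  ... | true  = refl
  ... | false = contradiction (a<b , refl) ¬blue

  blue≡0⇒red : ∀ {a b} → a < b → blue a b ≡ 0 → colour a b ≡ true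
  blue≡0⇒red {a} {b} a<b eq = not-blue⇒red a<b λ ab → contradiction (trans (sym (𝟙-yes (blue? a b) ab)) eq) λ ()

  module _ {m : ℕ} (σ : Vec (Fin m) m) where

    red-copy : (φ : Fin (m + m) → ℕ) → (∀ {x y} → x F.< y → φ x < φ y) → (∀ x → φ x < N) →
               (∀ i → colour (φ (i ↑ˡ m)) (φ (m ↑ʳ lookup σ i)) ≡ true) → RedMatchingCopy σ col
    red-copy φ φ↑ φ<N red = (λ x → φ x mod N) , (λ x y x<y → mod-< (φ↑ x<y) (φ<N y)) , red

    -- All left vertices precede all right ones, so each matching edge joins two clique vertices in
    -- increasing order and is red.
    red-clique : (φ : Fin (m + m) → ℕ) → (∀ {x y} → x F.< y → φ x < φ y) → (∀ x → φ x < N) →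
                 (∀ {x y} → x F.< y → ¬ Blue (φ x) (φ y)) → RedMatchingCopy σ col
    red-clique φ φ↑ φ<N ¬blue = red-copy φ φ↑ φ<N λ i → let lt = left<right i in not-blue⇒red (φ↑ lt) (¬blue lt)
      where
      left<right : ∀ i → i ↑ˡ m F.< m ↑ʳ lookup σ i
      left<right i = subst₂ _<_ (sym (toℕ-↑ˡ i m)) (sym (toℕ-↑ʳ m (lookup σ i))) (<-≤-trans (toℕ<n i) (m≤m+n m _))

    module _ (no-triangle : ¬ BlueTriangle col) where

      -- Two later blue neighbours of `r` joined by a blue edge would form a triangle with `r`. So
      -- `m + m` of them span a red clique, which contains the matching.
      row-degree : ∀ {r} → r < N → ∑ (upTo N) (blue r) ≤ m + m ⊎ RedMatchingCopy σ col
      row-degree {r} r<N with ≤-total (∑ (upTo N) (blue r)) (m + m)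
      ... | inj₁ deg≤ = inj₁ deg≤
      ... | inj₂ deg≥ with increasing-selection (blue? r) (m + m) N deg≥
      ...   | φ , φ↑ , φ-blue = inj₂ (red-clique φ φ↑ (λ x → proj₁ (φ-blue x)) λ {x} {y} _ xy →
              no-triangle (blue-triangle (proj₁ (φ-blue y)) (proj₂ (φ-blue x)) (proj₂ (φ-blue y)) xy))

      -- The same with the earlier blue neighbours of `c`, where `c` is the last vertex of the
      -- triangle.
      column-degree : ∀ {c} → c < N → ∑ (upTo N) (λ r → blue r c) ≤ m + m ⊎ RedMatchingCopy σ col
      column-degree {c} c<N with ≤-total (∑ (upTo N) (λ r → blue r c)) (m + m)
      ... | inj₁ deg≤ = inj₁ deg≤
      ... | inj₂ deg≥ with increasing-selection (λ r → blue? r c) (m + m) N deg≥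
      ...   | φ , φ↑ , φ-blue = inj₂ (red-clique φ φ↑ (λ x → proj₁ (φ-blue x)) λ {x} {y} _ xy →
              no-triangle (blue-triangle c<N xy (proj₂ (φ-blue x)) (proj₂ (φ-blue y))))

  blueTriangle? : Dec (BlueTriangle col)
  blueTriangle? = Fin.any? λ a → Fin.any? λ b → Fin.any? λ c →
    (a F.<? b) ×-dec (b F.<? c) ×-dec (col a b Bool.≟ false) ×-dec (col a c Bool.≟ false) ×-dec (col b c Bool.≟ false)

-- Assembling the red copy

module Embedding {m : ℕ} (σ : Vec (Fin m) m) (σ-perm : IsPerm σ)
  (w H T Λ R N : ℕ) .{{_ : NonZero w}} .{{_ : NonZero H}} .{{_ : NonZero N}} where

  D width : ℕ
  D = m + m
  width = D + D + w

  -- Positions from `R` on are cut into windows of length `width`, one per group: `w` places for its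
  -- vertices and `D + D` for sliding, so that no slide reaches the next window.
  slot : ℕ → ℕ
  slot j = R + (j / w * width + j % w)

  -- Within a group the common slide preserves the order; different groups stay in disjoint windows.
  slots-increasing : ∀ (k : ℕ → ℕ) → (∀ g → k g < D + D) → ∀ {i j} → i < j → slot i + k (i / w) < slot j + k (j / w)
  slots-increasing k k<S {i} {j} i<j with m≤n⇒m<n∨m≡n (/-monoˡ-≤ w (<⇒≤ i<j))
  ... | inj₂ same = +-mono-<-≤ (+-monoʳ-< R (+-mono-≤-< (≤-reflexive (cong (_* width) same)) remainder<))
                               (≤-reflexive (cong k same))
    where
    remainder< : i % w < j % w
    remainder< = +-cancelʳ-< (i / w * w) _ _ (subst₂ _<_ (m≡m%n+[m/n]*n i w)
      (trans (m≡m%n+[m/n]*n j w) (cong (λ q → j % w + q * w) (sym same))) i<j)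
  ... | inj₁ q<q′ = begin-strict
    R + (i / w * width + i % w) + k (i / w)      ≡⟨ trans (+-assoc R _ _) (cong (R +_) (+-assoc (i / w * width) _ _)) ⟩
    R + (i / w * width + (i % w + k (i / w)))    <⟨ +-monoʳ-< R (+-monoʳ-< (i / w * width) (+-mono-< (m%n<n i w) (k<S (i / w)))) ⟩
    R + (i / w * width + (w + (D + D)))          ≡⟨ cong (λ a → R + (i / w * width + a)) (+-comm w (D + D)) ⟩
    R + (i / w * width + width)                  ≡⟨ cong (R +_) (+-comm (i / w * width) width) ⟩
    R + (suc (i / w) * width)                    ≤⟨ +-monoʳ-≤ R (*-monoˡ-≤ width q<q′) ⟩
    R + j / w * width                            ≤⟨ +-monoʳ-≤ R (m≤m+n _ (j % w)) ⟩
    slot j                                       ≤⟨ m≤m+n (slot j) _ ⟩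
    slot j + k (j / w)                           ∎
    where open ≤-Reasoning

  module _
    (row-bound : ∀ {t l} (i : Fin m) → t < T → l < Λ → row H t l i < R)
    (slot-bound : ∀ (j : Fin m) {k} → k < D + D → slot (toℕ j) + k < N)
    (R≤N : R ≤ N)
    (room : (m * w) * ((D + D) * ((D + D) * (D * D))) + closePairs (values σ) w H * ((D + D) * (Λ * D) * D)
            < T * Λ * ((D + D) * D))
    where

    -- Without a blue triangle, a large degree yields a red clique and with it the copy; otherwise
    -- all degrees are at most `D` and `placement` applies.
    arrows : Arrows N σ
    arrows col = case blueTriangle? of λ
      { (yes triangle)   → inj₂ triangle
      ; (no no-triangle) → inj₁ (case all-or N (row-degree σ no-triangle) of λ
          { (inj₂ copy) → copy
          ; (inj₁ rows) → case all-or N (column-degree σ no-triangle) of λ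
              { (inj₂ copy)    → copy
              ; (inj₁ columns) → embed rows columns } }) }
      where
      open Coloured col
      embed : (∀ {r} → r < N → ∑ (upTo N) (blue r) ≤ D) → (∀ {c} → c < N → ∑ (upTo N) (λ r → blue r c) ≤ D) →
              RedMatchingCopy σ col
      embed rows columns = build (placement room)
        where
        open Placement (values σ) (λ eq → σ-perm _ _ (toℕ-injective eq)) w H T Λ D N slot blue rows columns
          (λ i t<T l<Λ → <-≤-trans (row-bound i t<T l<Λ) R≤N) (λ i → slot-bound (lookup σ i))
        build : (∃₂ λ t l → t < T × l < Λ × (∀ g → Free t l g)) → RedMatchingCopy σ col
        build (t , l , t<T , l<Λ , free) = red-copy σ (glue top bottom)
          (glue-increasing top↑ (slots-increasing k k<S) top<bottom) bounded red
          where
          k : ℕ → ℕ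
          k g = proj₁ (free g)
          k<S : ∀ g → k g < D + D
          k<S g = proj₁ (proj₂ (free g))
          top bottom : Fin m → ℕ
          top = row H t l
          bottom j = slot (toℕ j) + k (toℕ j / w)
          top<R : ∀ i → top i < R
          top<R i = row-bound i t<T l<Λ
          top<bottom : ∀ i j → top i < bottom j
          top<bottom i j = <-≤-trans (top<R i) (≤-trans (m≤m+n R _) (m≤m+n _ _))
          top↑ : ∀ {i j} → i F.< j → top i < top j
          top↑ i<j = +-mono-<-≤ i<j (+-monoʳ-≤ t (*-monoʳ-≤ l (/-monoˡ-≤ H (<⇒≤ i<j))))
          bounded : ∀ x → glue top bottom x < N
          bounded x with splitAt m x
          ... | inj₁ i = <-≤-trans (top<R i) R≤N
          ... | inj₂ j = slot-bound j (k<S _)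
          red : ∀ i → colour (glue top bottom (i ↑ˡ m)) (glue top bottom (m ↑ʳ lookup σ i)) ≡ true
          red i = subst₂ (λ a b → colour a b ≡ true)
            (cong [ top , bottom ]′ (sym (splitAt-↑ˡ m i m)))
            (cong [ top , bottom ]′ (sym (splitAt-↑ʳ m m (lookup σ i))))
            -- The cell of edge `i` is the one tested by the freeness of the group containing its
            -- right end `values σ i`.
            (blue≡0⇒red (top<bottom i (lookup σ i)) (proj₂ (proj₂ (free (values σ i / w))) i refl))

-- Choice of the parameters

-- Induction on `m`: adding 1 to `m` raises the integer root by at most 1.
root : ∀ e .{{_ : NonZero e}} m → ∃ λ x → x ^ e ≤ m × m < suc x ^ e
root e@(suc _) zero    = 0 , z≤n , ≤-reflexive (sym (^-zeroˡ e))
root e         (suc m) with root e m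
... | x , x^e≤m , m<1+x^e with suc m <? suc x ^ e
...   | yes lt = x , m≤n⇒m≤1+n x^e≤m , lt
...   | no  ≮  = suc x , ≮⇒≥ ≮ , ≤-<-trans m<1+x^e (^-monoˡ-< e (n<1+n (suc x)))

^-distribʳ-* : ∀ n a b → (a * b) ^ n ≡ a ^ n * b ^ n
^-distribʳ-* zero    a b = refl
^-distribʳ-* (suc n) a b = trans (cong (a * b *_) (^-distribʳ-* n a b)) (interchange *-commutativeSemigroup a b (a ^ n) (b ^ n))

-- In units of `x ^ 24`: `1 + 2 * B` for the left part, and for the right part at most `B * x ^ 11`
-- windows of length at most `(4 * B + 1) * x ^ 13`.
ramseyConstant : ℕ → ℕ
ramseyConstant B = 1 + 2 * B + B * (4 * B + 1)

-- The sum of the coefficients of `x ^ 41` and `x ^ 40` in `room`; for larger `x` the total stays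
-- below `x ^ 42`.
threshold : ℕ → ℕ → ℕ
threshold B q = 8 * (B * B * B) + 4 * (q * B)

module Parameters (B x m : ℕ) .{{_ : NonZero x}} .{{_ : NonZero m}} (m≤ : m ≤ B * x ^ 13) where

  R N : ℕ
  R = (1 + 2 * B) * x ^ 24
  N = ramseyConstant B * x ^ 24

  instance
    x²≢0 : NonZero (x ^ 2)
    x²≢0 = m^n≢0 x 2
    x⁷≢0 : NonZero (x ^ 7)
    x⁷≢0 = m^n≢0 x 7
    N≢0 : NonZero N
    N≢0 = m*n≢0 (ramseyConstant B) (x ^ 24) {{_}} {{m^n≢0 x 24}}

  open ≤-Reasoning

  R≤N : R ≤ N
  R≤N = *-monoˡ-≤ (x ^ 24) (m≤m+n (1 + 2 * B) _)

  quotient-bound : ∀ a b .{{_ : NonZero (x ^ b)}} → x ^ 13 ≡ x ^ a * x ^ b → (i : Fin m) → toℕ i / x ^ b < B * x ^ a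
  quotient-bound a b split i = m<n*o⇒m/o<n (begin-strict
    toℕ i                 <⟨ toℕ<n i ⟩
    m                     ≤⟨ m≤ ⟩
    B * x ^ 13            ≡⟨ cong (B *_) split ⟩
    B * (x ^ a * x ^ b)   ≡⟨ *-assoc B (x ^ a) (x ^ b) ⟨
    B * x ^ a * x ^ b     ∎)

  -- The three terms are at most `B * x ^ 24`, `x ^ 24` and `x ^ 18 * (B * x ^ 6)`, which `R`
  -- collects.
  row-bound : ∀ {t l} (i : Fin m) → t < x ^ 24 → l < x ^ 18 → row (x ^ 7) t l i < R
  row-bound {t} {l} i t<T l<Λ = begin-strict
    toℕ i + (t + l * (toℕ i / x ^ 7))
      <⟨ +-mono-<-≤ (toℕ<n i) (+-mono-≤ (<⇒≤ t<T) (*-mono-≤ (<⇒≤ l<Λ) (<⇒≤ (quotient-bound 6 7 (^-distribˡ-+-* x 6 7) i)))) ⟩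
    m + (x ^ 24 + x ^ 18 * (B * x ^ 6))
      ≤⟨ +-monoˡ-≤ _ (≤-trans m≤ (*-monoʳ-≤ B (^-monoʳ-≤ x (m≤m+n 13 11)))) ⟩
    B * x ^ 24 + (x ^ 24 + x ^ 18 * (B * x ^ 6))
      ≡⟨ cong (λ a → B * x ^ 24 + (x ^ 24 + a)) (trans (swap-factors (x ^ 18) B (x ^ 6)) (cong (B *_) (sym (^-distribˡ-+-* x 18 6)))) ⟩
    B * x ^ 24 + (x ^ 24 + B * x ^ 24)
      ≡⟨ collect B (x ^ 24) ⟩
    R ∎
    where
    swap-factors : ∀ a b c → a * (b * c) ≡ b * (a * c)
    swap-factors = solve-∀
    collect : ∀ b y → b * y + (y + b * y) ≡ (1 + 2 * b) * y
    collect = solve-∀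

  slot-bound : (σ : Vec (Fin m) m) (σ-perm : IsPerm σ) (j : Fin m) {k : ℕ} → k < (m + m) + (m + m) →
               Embedding.slot σ σ-perm (x ^ 2) (x ^ 7) (x ^ 24) (x ^ 18) R N (toℕ j) + k < N
  slot-bound _ _ j {k} k<S = begin-strict
    R + (g * width + toℕ j % x ^ 2) + k
      ≡⟨ trans (+-assoc R _ k) (cong (R +_) (+-assoc (g * width) _ k)) ⟩
    R + (g * width + (toℕ j % x ^ 2 + k))
      <⟨ +-monoʳ-< R (+-monoʳ-< (g * width) (+-mono-< (m%n<n (toℕ j) (x ^ 2)) k<S)) ⟩
    R + (g * width + (x ^ 2 + (m + m + (m + m))))
      ≡⟨ cong (R +_) (trans (cong (g * width +_) (+-comm (x ^ 2) _)) (+-comm (g * width) width)) ⟩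
    R + suc g * width
      ≤⟨ +-monoʳ-≤ R (*-mono-≤ (quotient-bound 11 2 (^-distribˡ-+-* x 11 2) j) width≤) ⟩
    R + B * x ^ 11 * ((4 * B + 1) * x ^ 13)
      ≡⟨ cong (R +_) (trans (regroup B (x ^ 11) (4 * B + 1) (x ^ 13)) (cong (B * (4 * B + 1) *_) (sym (^-distribˡ-+-* x 11 13)))) ⟩
    R + B * (4 * B + 1) * x ^ 24
      ≡⟨ *-distribʳ-+ (x ^ 24) (1 + 2 * B) (B * (4 * B + 1)) ⟨
    N ∎
    where
    g = toℕ j / x ^ 2
    width = m + m + (m + m) + x ^ 2
    regroup : ∀ a b c d → a * b * (c * d) ≡ a * c * (b * d)
    regroup = solve-∀
    four : ∀ b y → b * y + b * y + (b * y + b * y) + y ≡ (4 * b + 1) * y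
    four = solve-∀
    width≤ : width ≤ (4 * B + 1) * x ^ 13
    width≤ = begin
      width                             ≤⟨ +-mono-≤ (+-mono-≤ (+-mono-≤ m≤ m≤) (+-mono-≤ m≤ m≤)) (^-monoʳ-≤ x (m≤m+n 2 11)) ⟩
      B * x ^ 13 + B * x ^ 13 + (B * x ^ 13 + B * x ^ 13) + x ^ 13 ≡⟨ four B (x ^ 13) ⟩
      (4 * B + 1) * x ^ 13              ∎

  -- After cancelling `S * D`, general pairs contribute order `x ^ (13 + 2 + 26)` and close pairs
  -- order `x ^ (9 + 18 + 13)`, against `x ^ (24 + 18)` shifts.
  room : ∀ q {P} → threshold B q < x → P ≤ q * (2 * (x ^ 7 * x ^ 2)) →
         let D = m + m; S = D + D in
         m * x ^ 2 * (S * (S * (D * D))) + P * (S * (x ^ 18 * D) * D) < x ^ 24 * x ^ 18 * (S * D)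
  room q {P} q<x P≤ = begin-strict
    m * x ^ 2 * (S * (S * (D * D))) + P * (S * (x ^ 18 * D) * D)
      ≡⟨ factor (m * x ^ 2) S D P (x ^ 18) ⟩
    (m * x ^ 2 * (S * D) + P * (x ^ 18 * D)) * (S * D)
      <⟨ *-monoˡ-< (S * D) {{m*n≢0 S D {{S≢0}} {{D≢0}}}} small ⟩
    x ^ 24 * x ^ 18 * (S * D) ∎
    where
    D = m + m
    S = D + D
    y = x ^ 13
    E = B * y + B * y
    D≢0 : NonZero D
    D≢0 = >-nonZero (<-≤-trans (>-nonZero⁻¹ m) (m≤m+n m m))
    S≢0 : NonZero S
    S≢0 = >-nonZero (<-≤-trans (>-nonZero⁻¹ m) (≤-trans (m≤m+n m m) (m≤m+n D D)))
    factor : ∀ a s d p l → a * (s * (s * (d * d))) + p * (s * (l * d) * d) ≡ (a * (s * d) + p * (l * d)) * (s * d)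
    factor = solve-∀
    D≤E : D ≤ E
    D≤E = +-mono-≤ m≤ m≤
    expand : ∀ b y z q x⁷ x¹⁸ → b * y * z * ((b * y + b * y + (b * y + b * y)) * (b * y + b * y)) + q * (2 * (x⁷ * z)) * (x¹⁸ * (b * y + b * y))
             ≡ 8 * (b * b * b) * (y * y * y * z) + 4 * (q * b) * (x⁷ * z * x¹⁸ * y)
    expand = solve-∀
    power₁ : y * y * y * x ^ 2 ≡ x ^ 41
    power₁ = trans (cong (_* x ^ 2) (trans (cong (_* y) (sym (^-distribˡ-+-* x 13 13))) (sym (^-distribˡ-+-* x 26 13)))) (sym (^-distribˡ-+-* x 39 2))
    power₂ : x ^ 7 * x ^ 2 * x ^ 18 * y ≡ x ^ 40
    power₂ = trans (cong (_* y) (trans (cong (_* x ^ 18) (sym (^-distribˡ-+-* x 7 2))) (sym (^-distribˡ-+-* x 9 18)))) (sym (^-distribˡ-+-* x 27 13))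
    small : m * x ^ 2 * (S * D) + P * (x ^ 18 * D) < x ^ 24 * x ^ 18
    small = begin-strict
      m * x ^ 2 * (S * D) + P * (x ^ 18 * D)
        ≤⟨ +-mono-≤ (*-mono-≤ (*-monoˡ-≤ (x ^ 2) m≤) (*-mono-≤ (+-mono-≤ D≤E D≤E) D≤E)) (*-mono-≤ P≤ (*-monoʳ-≤ (x ^ 18) D≤E)) ⟩
      B * y * x ^ 2 * ((E + E) * E) + q * (2 * (x ^ 7 * x ^ 2)) * (x ^ 18 * E)
        ≡⟨ expand B y (x ^ 2) q (x ^ 7) (x ^ 18) ⟩
      8 * (B * B * B) * (y * y * y * x ^ 2) + 4 * (q * B) * (x ^ 7 * x ^ 2 * x ^ 18 * y)
        ≡⟨ cong₂ (λ a b → 8 * (B * B * B) * a + 4 * (q * B) * b) power₁ power₂ ⟩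
      8 * (B * B * B) * x ^ 41 + 4 * (q * B) * x ^ 40
        ≤⟨ +-monoʳ-≤ (8 * (B * B * B) * x ^ 41) (*-monoʳ-≤ (4 * (q * B)) (^-monoʳ-≤ x (n≤1+n 40))) ⟩
      8 * (B * B * B) * x ^ 41 + 4 * (q * B) * x ^ 41
        ≡⟨ *-distribʳ-+ (x ^ 41) (8 * (B * B * B)) (4 * (q * B)) ⟨
      threshold B q * x ^ 41
        <⟨ *-monoˡ-< (x ^ 41) {{m^n≢0 x 41}} q<x ⟩
      x ^ 42
        ≡⟨ ^-distribˡ-+-* x 24 18 ⟩
      x ^ 24 * x ^ 18 ∎

  -- The source of the exponent 24/13: `N` is a constant times `x ^ 24`, and
  -- `(x ^ 24) ^ 13 = (x ^ 13) ^ 24`.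
  N-bound : x ^ 13 ≤ m → N ^ 13 ≤ ramseyConstant B ^ 13 * m ^ 24
  N-bound x¹³≤m = begin
    (c * x ^ 24) ^ 13       ≡⟨ ^-distribʳ-* 13 c (x ^ 24) ⟩
    c ^ 13 * (x ^ 24) ^ 13  ≡⟨ cong (c ^ 13 *_) (trans (^-*-assoc x 24 13) (sym (^-*-assoc x 13 24))) ⟩
    c ^ 13 * (x ^ 13) ^ 24  ≤⟨ *-monoʳ-≤ (c ^ 13) (^-monoˡ-≤ 24 x¹³≤m) ⟩
    c ^ 13 * m ^ 24         ∎
    where c = ramseyConstant B

  sparse⇒bound : ∀ q (σ : Vec (Fin m) m) → IsPerm σ → x ^ 13 ≤ m → threshold B q < x →
                 closePairs (values σ) (x ^ 2) (x ^ 7) ≤ q * (2 * (x ^ 7 * x ^ 2)) →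
                 RamseyBound (ramseyConstant B) m σ
  sparse⇒bound q σ σ-perm x¹³≤m q<x sparse = N , N-bound x¹³≤m ,
    Embedding.arrows σ σ-perm (x ^ 2) (x ^ 7) (x ^ 24) (x ^ 18) R N
      row-bound (slot-bound σ σ-perm) R≤N (room q q<x sparse)

mostly-bounded : ∀ B → (∀ x .{{_ : NonZero x}} → suc x ^ 13 ≤ B * x ^ 13) → ∀ p q → 0 < p →
  ∃ λ (m₀ : ℕ) → ∀ (m : ℕ) → m₀ ≤ m →
    Σ (List (Vec (Fin m) m)) λ L →
      Unique L × All IsPerm L × All (RamseyBound (ramseyConstant B) m) L × (q ∸ p) * (m !) ≤ q * length L
-- The summand 2 serves `sparsePerms-many`; the power forces the 13th root of `m` above
-- `threshold B q`.
mostly-bounded B doubling p q 0<p = 2 + suc (threshold B q) ^ 13 , λ m m₀≤m →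
  at m (≤-trans (m≤m+n 2 _) m₀≤m) (≤-trans (m≤n+m _ 2) m₀≤m) (root 13 m)
  where
  at : ∀ m → 2 ≤ m → suc (threshold B q) ^ 13 ≤ m → (∃ λ x → x ^ 13 ≤ m × m < suc x ^ 13) →
       Σ (List (Vec (Fin m) m)) λ L →
         Unique L × All IsPerm L × All (RamseyBound (ramseyConstant B) m) L × (q ∸ p) * (m !) ≤ q * length L
  at m 2≤m large (x , x¹³≤m , m<1+x¹³) = L , Uniq.filter⁺ sparse? (perms-unique m) ,
      All.tabulate (λ {σ} σ∈ → perms-sound m (proj₁ (unfilter σ∈))) ,
      All.tabulate (λ {σ} σ∈ → sparse⇒bound q σ (perms-sound m (proj₁ (unfilter σ∈))) x¹³≤m q<x (proj₂ (unfilter σ∈))) ,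
      count
    where
    q<x : threshold B q < x
    q<x = s≤s⁻¹ (≰⇒> λ 1+x≤ → <⇒≱ m<1+x¹³ (≤-trans (^-monoˡ-≤ 13 1+x≤) large))
    instance
      x≢0 : NonZero x
      x≢0 = >-nonZero (≤-<-trans z≤n q<x)
      m≢0 : NonZero m
      m≢0 = >-nonZero (≤-trans (s≤s z≤n) 2≤m)
    open Parameters B x m (≤-trans (<⇒≤ m<1+x¹³) (doubling x))
    K = q * (2 * (x ^ 7 * x ^ 2))
    sparse? : (σ : Vec (Fin m) m) → Dec (closePairs (values σ) (x ^ 2) (x ^ 7) ≤ K)
    sparse? σ = closePairs (values σ) (x ^ 2) (x ^ 7) ≤? K
    L : List (Vec (Fin m) m)
    L = sparsePerms m (x ^ 2) (x ^ 7) K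
    unfilter : ∀ {σ} → σ ∈ L → σ ∈ perms m × closePairs (values σ) (x ^ 2) (x ^ 7) ≤ K
    unfilter = ∈-filter⁻ sparse? {xs = perms m}
    open ≤-Reasoning
    count : (q ∸ p) * m ! ≤ q * length L
    count = begin
      (q ∸ p) * m !                  ≡⟨ *-distribʳ-∸ (m !) q p ⟩
      q * m ! ∸ p * m !              ≤⟨ m≤n+o⇒m∸n≤o (q * m !) (p * m !) (begin
        q * m !                        ≤⟨ sparsePerms-many m (x ^ 2) (x ^ 7) q 2≤m ⟩
        -- The exceptional share is at most `1 / q`, and `p` is at least 1.
        q * length L + m !             ≤⟨ +-monoʳ-≤ (q * length L) (≤-trans (≤-reflexive (sym (*-identityˡ (m !)))) (*-monoˡ-≤ (m !) 0<p)) ⟩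
        q * length L + p * m !         ≡⟨ +-comm (q * length L) _ ⟩
        p * m ! + q * length L         ∎) ⟩
      q * length L                   ∎

theorem16 : ∃ λ (c : ℕ) → ∀ (p q : ℕ) → 0 < p → 0 < q →
    ∃ λ (m₀ : ℕ) → ∀ (m : ℕ) → m₀ ≤ m → 0 < m →
    Σ (List (Vec (Fin m) m)) λ L →
    Unique L × All IsPerm L × All (RamseyBound c m) L ×
    (q ∸ p) * (m !) ≤ q * length L
-- The value `2 ^ 13` comes from `suc x ≤ 2 * x` for positive `x`, raised to the 13th power.
theorem16 = ramseyConstant (2 ^ 13) , λ p q 0<p _ →
  let m₀ , at = mostly-bounded (2 ^ 13) doubling p q 0<p in m₀ , λ m m₀≤m _ → at m m₀≤m
  where
  doubling : ∀ x .{{_ : NonZero x}} → suc x ^ 13 ≤ 2 ^ 13 * x ^ 13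
  doubling x = ≤-trans (^-monoˡ-≤ 13 (+-mono-≤ (>-nonZero⁻¹ x) (m≤m+n x 0))) (≤-reflexive (^-distribʳ-* 13 2 x))
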